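{- Let $k,s\ge 1$ be integers with $ks\ge 2$, and let $G$ be a graph of order $p$ and size $q$ with $d\ge 0$ pendant edges. Consider the following conditions: (a) $\chi_{lt}(G)=t=\Delta(G)+1$, and a corresponding local total antimagic labeling $f$ of $G$ (one inducing exactly $t$ distinct weights) assigns $k$ to a maximum degree vertex $v$ of $G$; (b) $w_f(v)+\sum_{j=1}^{s}\sum_{i=1}^{k}(p+q+2jk+1-i)\ne w_f(x)$ for each vertex $x$ adjacent to $v$ in $G$; (c) $v$ is the only element of $V(G)\cup E(G)$ with weight $w_f(v)$, or else there is an element of $V(G)\cup E(G)$ that is not a pendant vertex and whose weight under $f$ is in $\{p+q+(2j-1)k+i \mid 1\le j\le s,\ 1\le i\le k\}$. Let $G_v(k,s)$ be the graph obtained from $G$ by attaching $ks$ pendant edges to $v$. If conditions (a) and (b) are satisfied, then $$\Delta(G_v(k,s))+1\le \chi_{lt}(G_v(k,s))\le \Delta(G_v(k,s))+2 .$$ If condition (c) is also satisfied, then the lower bound is attained, i.e. $\chi_{lt}(G_v(k,s))=\Delta(G_v(k,s))+1$.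
   Context: All graphs $G$ are finite, simple and loopless, of order $p=|V(G)|\ge 3$ and size $q=|E(G)|\ge 2$, with no isolated vertex and no $K_2$ component (graphs may be disconnected). $\Delta(G)$ is the maximum degree. A pendant vertex is a vertex of degree 1; a pendant edge is an edge incident to a pendant vertex. Attaching $r$ pendant edges to $v$ means adding $r$ new vertices, each joined only to $v$. A local total antimagic labeling of $G=(V,E)$ is a bijection $f:V\cup E\to\{1,\dots,p+q\}$ such that, with weights $w_f(u)=\sum f(e)$ over all edges $e$ incident to $u$ for $u\in V$ (the label of $u$ itself is not included) and $w_f(uv)=f(u)+f(v)$ for $uv\in E$, one has: adjacent vertices have distinct weights, adjacent edges have distinct weights, and every vertex has a weight distinct from that of each of its incident edges. $\chi_{lt}(G)$ is the minimum, over all local total antimagic labelings $f$ of $G$, of the number of distinct values among all the vertex and edge weights. -}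

module Defs where

open import Data.Nat using (ℕ; suc; _+_; _≤_; _<_; _≟_)
open import Data.Nat.ListAction using (sum)
open import Data.Nat.Properties using (<-irrefl; <-≤-trans; m≤m+n)
open import Data.Fin using (Fin; toℕ; splitAt; _↑ˡ_; _↑ʳ_)
import Data.Fin as Fin
open import Data.Fin.Properties
  using (toℕ<n; toℕ-↑ˡ; toℕ-↑ʳ; ↑ˡ-injective; ↑ʳ-injective;
         splitAt⁻¹-↑ˡ; splitAt⁻¹-↑ʳ)
open import Data.List
  using (List; length; map; filter; allFin; applyUpTo; deduplicate; _++_)
open import Data.List.Extrema.Nat using (max)
open import Data.Product using (Σ; ∃; _×_; _,_; proj₁; proj₂)
open import Data.Sum using (_⊎_; inj₁; inj₂; [_,_]′)
open import Data.Empty using (⊥-elim)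
open import Function using (_∘_)
open import Function.Bundles using (_⤖_; module Bijection)
open import Function.Definitions using (Injective)
open import Relation.Nullary using (¬_; Dec; _⊎-dec_)
open import Relation.Binary.PropositionalEquality
  using (_≡_; _≢_; refl; sym; trans; cong; subst₂)

-- A finite simple graph on the vertex set Fin p whose edges are enumerated by
-- Fin q.  The edge {u , w} is stored as the pair (u , w) with u < w; this rules
-- out loops, and injectivity of ends rules out parallel edges.
record Graph (p q : ℕ) : Set where
  field
    ends     : Fin q → Fin p × Fin p
    ordered  : ∀ e → proj₁ (ends e) Fin.< proj₂ (ends e)
    distinct : Injective _≡_ _≡_ ends

  src tgt : Fin q → Fin p
  src e = proj₁ (ends e)
  tgt e = proj₂ (ends e)

  Incident : Fin p → Fin q → Set
  Incident u e = (src e ≡ u) ⊎ (tgt e ≡ u)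

  incident? : ∀ u e → Dec (Incident u e)
  incident? u e = (src e Fin.≟ u) ⊎-dec (tgt e Fin.≟ u)

  incidentEdges : Fin p → List (Fin q)
  incidentEdges u = filter (incident? u) (allFin q)

  Adjacent : Fin p → Fin p → Set
  Adjacent u w = u ≢ w × ∃ λ e → Incident u e × Incident w e

  AdjacentEdges : Fin q → Fin q → Set
  AdjacentEdges e e′ = e ≢ e′ × ∃ λ u → Incident u e × Incident u e′

  deg : Fin p → ℕ
  deg u = length (incidentEdges u)

  Δ : ℕ
  Δ = max 0 (map deg (allFin p))

  Pendant : Fin p → Set
  Pendant u = deg u ≡ 1

  PendantEdge : Fin q → Set
  PendantEdge e = Pendant (src e) ⊎ Pendant (tgt e)

  pendantEdge? : ∀ e → Dec (PendantEdge e)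
  pendantEdge? e = (deg (src e) ≟ 1) ⊎-dec (deg (tgt e) ≟ 1)

  #pendantEdges : ℕ
  #pendantEdges = length (filter pendantEdge? (allFin q))

  -- The component containing e is e together with its two ends.
  K₂Component : Fin q → Set
  K₂Component e = ∀ e′ → ¬ AdjacentEdges e e′

open Graph public

record Admissible {p q : ℕ} (G : Graph p q) : Set where
  field
    order≥3        : 3 ≤ p
    size≥2         : 2 ≤ q
    noIsolated     : ∀ u → ∃ λ e → Incident G u e
    noK₂Component  : ∀ e → ¬ K₂Component G e

-- V ∪ E
Element : ℕ → ℕ → Set
Element p q = Fin p ⊎ Fin q

elements : ∀ p q → List (Element p q)
elements p q = map inj₁ (allFin p) ++ map inj₂ (allFin q)

-- A bijection V ∪ E → {1, …, p + q} is stored shifted by one, as a bijection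
-- onto Fin (p + q); label gives the actual value.
Labeling : ℕ → ℕ → Set
Labeling p q = Element p q ⤖ Fin (p + q)

label : ∀ {p q} → Labeling p q → Element p q → ℕ
label f x = suc (toℕ (Bijection.to f x))

weight : ∀ {p q} → Graph p q → Labeling p q → Element p q → ℕ
weight G f (inj₁ u) = sum (map (label f ∘ inj₂) (incidentEdges G u))
weight G f (inj₂ e) = label f (inj₁ (src G e)) + label f (inj₁ (tgt G e))

record LocalTotalAntimagic {p q : ℕ} (G : Graph p q) (f : Labeling p q) : Set where
  field
    vertices≢ : ∀ u w → Adjacent G u w → weight G f (inj₁ u) ≢ weight G f (inj₁ w)
    edges≢    : ∀ e e′ → AdjacentEdges G e e′ → weight G f (inj₂ e) ≢ weight G f (inj₂ e′)
    incident≢ : ∀ u e → Incident G u e → weight G f (inj₁ u) ≢ weight G f (inj₂ e)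

#weights : ∀ {p q} → Graph p q → Labeling p q → ℕ
#weights {p} {q} G f = length (deduplicate _≟_ (map (weight G f) (elements p q)))

-- χ_lt(G) = t, as a relation: χ_lt is a minimum over a set of labelings that
-- is not known in advance to be nonempty.
χlt≡ : ∀ {p q} → Graph p q → ℕ → Set
χlt≡ {p} {q} G t =
  (Σ (Labeling p q) λ f → LocalTotalAntimagic G f × #weights G f ≡ t)
  × (∀ (f : Labeling p q) → LocalTotalAntimagic G f → t ≤ #weights G f)

-- ∑[1⋯ n ] F = F 1 + F 2 + ⋯ + F n
∑[1⋯_] : ℕ → (ℕ → ℕ) → ℕ
∑[1⋯ n ] F = sum (applyUpTo (F ∘ suc) n)

module _ {p q : ℕ} (G : Graph p q) (v : Fin p) (m : ℕ) where

  private
    oldEnds : Fin q → Fin (p + m) × Fin (p + m)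
    oldEnds e = src G e ↑ˡ m , tgt G e ↑ˡ m

    newEnds : Fin m → Fin (p + m) × Fin (p + m)
    newEnds i = v ↑ˡ m , p ↑ʳ i

    ends′ : Fin q ⊎ Fin m → Fin (p + m) × Fin (p + m)
    ends′ = [ oldEnds , newEnds ]′

    ↑ˡ<↑ʳ : ∀ (u : Fin p) (i : Fin m) → (u ↑ˡ m) Fin.< (p ↑ʳ i)
    ↑ˡ<↑ʳ u i = subst₂ _<_ (sym (toℕ-↑ˡ u m)) (sym (toℕ-↑ʳ p i))
                  (<-≤-trans (toℕ<n u) (m≤m+n p (toℕ i)))

    ↑ˡ≢↑ʳ : ∀ (u : Fin p) (i : Fin m) → u ↑ˡ m ≢ p ↑ʳ i
    ↑ˡ≢↑ʳ u i eq = <-irrefl (cong toℕ eq) (↑ˡ<↑ʳ u i)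

    ordered′ : ∀ x → proj₁ (ends′ x) Fin.< proj₂ (ends′ x)
    ordered′ (inj₁ e) = subst₂ _<_ (sym (toℕ-↑ˡ (src G e) m)) (sym (toℕ-↑ˡ (tgt G e) m))
                          (ordered G e)
    ordered′ (inj₂ i) = ↑ˡ<↑ʳ v i

    pair≡ : ∀ {x y : Fin p × Fin p} → proj₁ x ≡ proj₁ y → proj₂ x ≡ proj₂ y → x ≡ y
    pair≡ refl refl = refl

    distinct′ : ∀ x y → ends′ x ≡ ends′ y → x ≡ y
    distinct′ (inj₁ e) (inj₁ e′) eq =
      cong inj₁ (distinct G (pair≡ (↑ˡ-injective m _ _ (cong proj₁ eq))
                                   (↑ˡ-injective m _ _ (cong proj₂ eq))))
    distinct′ (inj₁ e) (inj₂ i)  eq = ⊥-elim (↑ˡ≢↑ʳ _ i (cong proj₂ eq))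
    distinct′ (inj₂ i) (inj₁ e)  eq = ⊥-elim (↑ˡ≢↑ʳ _ i (sym (cong proj₂ eq)))
    distinct′ (inj₂ i) (inj₂ i′) eq = cong inj₂ (↑ʳ-injective p i i′ (cong proj₂ eq))

    splitAt-injective : ∀ (e e′ : Fin (q + m)) → splitAt q e ≡ splitAt q e′ → e ≡ e′
    splitAt-injective e e′ eq with splitAt q e in eq₁
    ... | inj₁ a = trans (sym (splitAt⁻¹-↑ˡ eq₁)) (splitAt⁻¹-↑ˡ (sym eq))
    ... | inj₂ b = trans (sym (splitAt⁻¹-↑ʳ {m = q} eq₁)) (splitAt⁻¹-↑ʳ {m = q} (sym eq))

  -- The vertices (edges) of G come first, followed by the m new pendant
  -- vertices (edges); the i-th new edge joins v to the i-th new vertex.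
  attachPendants : Graph (p + m) (q + m)
  attachPendants = record
    { ends     = ends′ ∘ splitAt q
    ; ordered  = ordered′ ∘ splitAt q
    ; distinct = λ {e} {e′} → splitAt-injective e e′ ∘ distinct′ (splitAt q e) (splitAt q e′)
    }

{-# OPTIONS --safe #-}
-- Label v and the rest of G by f, the ks new edges by the upper halves of s
-- consecutive blocks of 2k labels beyond p + q, and the new vertices by the
-- lower halves.  As f(v) = k, adding f(v) moves a lower half onto the upper half
-- of its block, so the new vertices and the new edges have the same set S of ks
-- weights; all of S exceeds the weights of the old edges at v.  Besides S and
-- old weights only w(v) + ΣS occurs, which gives t + ks + 1 = Δ(Gᵥ) + 2, and (c)
-- says that an old weight either disappears or lies in S.  Conversely a vertex
-- of maximum degree and its edges already have Δ + 1 different weights.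
module Submission where

open import Defs
open import Data.Nat
  using (ℕ; zero; suc; _+_; _*_; _∸_; _≤_; _<_; z≤n; s≤s; _≟_)
open import Data.Nat.ListAction using (sum)
open import Data.Nat.ListAction.Properties using (sum-++)
open import Data.Nat.Properties
open import Data.Nat.Tactic.RingSolver using (solve-∀)
open import Data.Fin
  using (Fin; zero; suc; toℕ; fromℕ; fromℕ<; splitAt; _↑ˡ_; _↑ʳ_; combine; remQuot; opposite; punchIn)
import Data.Fin as Fin
open import Data.Fin.Properties
  using (toℕ<n; toℕ-injective; toℕ-↑ˡ; toℕ-↑ʳ; toℕ-cast; toℕ-fromℕ<; toℕ-combine;
         opposite-prop; remQuot-combine; splitAt-↑ˡ; splitAt-↑ʳ;
         splitAt⁻¹-↑ˡ; splitAt⁻¹-↑ʳ; ↑ˡ-injective; ↑ʳ-injective;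
         +↔⊎; *↔×; any?; all?)
  renaming (suc-injective to Fin-suc-injective)
open import Data.Fin.Permutation using (cast-id; reverse; insert; insert-punchIn)
import Data.Fin.Permutation as Perm
open import Data.Vec.Functional using () renaming (_∷_ to _∷ᶠ_)
open import Data.List
  using (List; []; _∷_; [_]; length; map; filter; allFin; tabulate; deduplicate; _++_)
open import Data.List.Extrema.Nat using (max≤v⁺; xs≤max)
open import Data.List.Properties
  using (++-identityʳ; map-tabulate; tabulate-cong; filter-++; filter-≐; filter-all; filter-none;
         filter-notAll; map-++; map-∘; map-cong; length-map; length-++; length-tabulate)
open import Data.List.Membership.Propositional using (_∈_)
open import Data.List.Membership.Propositional.Properties
  using (∈-map⁺; ∈-map⁻; ∈-filter⁺; ∈-filter⁻; ∈-allFin; ∈-++⁺ˡ; ∈-++⁺ʳ;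
         ∈-deduplicate⁺; ∈-deduplicate⁻)
open import Data.List.Relation.Binary.Subset.Propositional using (_⊆_)
open import Data.List.Relation.Unary.All as All using ([]; _∷_)
import Data.List.Relation.Unary.All.Properties as All
open import Data.List.Relation.Unary.Any as Any using (here; there)
open import Data.List.Relation.Unary.AllPairs using ([]; _∷_)
open import Data.List.Relation.Unary.Unique.Propositional using (Unique)
import Data.List.Relation.Unary.Unique.Propositional.Properties as Unique
open import Data.List.Relation.Unary.Unique.DecPropositional.Properties _≟_ using (deduplicate-!)
open import Data.Product using (Σ; ∃; _×_; _,_; proj₁; proj₂; map₁)
open import Data.Product.Function.NonDependent.Propositional using (_×-↔_)
open import Data.Sum using (_⊎_; inj₁; inj₂; [_,_]′)
open import Data.Sum.Function.Propositional using (_⊎-↔_; _⊎-⤖_)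
open import Data.Sum.Properties using (inj₁-injective; inj₂-injective)
import Data.Sum.Properties as Sum
open import Function using (_∘_; id)
open import Function.Bundles using (_↔_; mk⤖; mk↔ₛ′; module Bijection; module Inverse)
open import Function.Construct.Composition using (_⤖-∘_; _↔-∘_)
open import Function.Construct.Identity using (↔-id)
open import Function.Construct.Symmetry using (↔-sym)
open import Function.Definitions using (Bijective)
open import Function.Consequences.Propositional using (strictlySurjective⇒surjective)
open import Function.Properties.Inverse using (↔⇒⤖)
open import Function.Related.TypeIsomorphisms using (×-distribˡ-⊎)
open import Relation.Binary.Definitions using (DecidableEquality)
open import Relation.Binary.PropositionalEquality
  using (_≡_; _≢_; _≗_; refl; sym; trans; cong; cong₂; subst; subst₂; ≢-sym; module ≡-Reasoning)
open import Relation.Nullary using (¬_; Dec; yes; no; ¬?; contradiction; _×-dec_; _⊎-dec_; _→-dec_)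
open import Relation.Nullary.Decidable using (map′)
open import Relation.Unary using (Decidable)

-- Lists and finite sets

private
  variable
    A B : Set

x∈xs⇒x≤sum : ∀ {x xs} → x ∈ xs → x ≤ sum xs
x∈xs⇒x≤sum {xs = y ∷ ys} (here refl) = m≤m+n y (sum ys)
x∈xs⇒x≤sum {xs = y ∷ ys} (there x∈) = ≤-trans (x∈xs⇒x≤sum x∈) (m≤n+m (sum ys) y)

module _ (_≟ᴬ_ : DecidableEquality A) where

  length-filter-≢ : ∀ {x xs} → x ∈ xs → length (filter (λ y → ¬? (y ≟ᴬ x)) xs) < length xs
  length-filter-≢ x∈ = filter-notAll _ _ (Any.map (λ x≡y y≢x → y≢x (sym x≡y)) x∈)

  -- Pigeonhole: deleting the head of `xs` from `ys` shortens `ys`, and the tail still fits because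
  -- it does not contain the head. All counts of weights reduce to this.
  unique-⊆⇒length≤ : ∀ {xs ys} → Unique xs → xs ⊆ ys → length xs ≤ length ys
  unique-⊆⇒length≤ [] _ = z≤n
  unique-⊆⇒length≤ (x≢xs ∷ u) sub =
    ≤-trans (s≤s (unique-⊆⇒length≤ u λ y∈ →
              ∈-filter⁺ _ (sub (there y∈)) (≢-sym (All.lookup x≢xs y∈))))
            (length-filter-≢ (sub (here refl)))

unique-map⁺ : ∀ {f : A → B} {xs} → (∀ {x y} → x ∈ xs → y ∈ xs → f x ≡ f y → x ≡ y) →
              Unique xs → Unique (map f xs)
unique-map⁺ inj [] = []
unique-map⁺ inj (x≢xs ∷ u) =
  All.map⁺ (All.tabulate λ y∈ fx≡fy → All.lookup x≢xs y∈ (inj (here refl) (there y∈) fx≡fy))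
  ∷ unique-map⁺ (λ x∈ y∈ → inj (there x∈) (there y∈)) u

filter-map : ∀ {P : B → Set} (P? : Decidable P) (f : A → B) xs →
             filter P? (map f xs) ≡ map f (filter (P? ∘ f) xs)
filter-map P? f [] = refl
filter-map P? f (x ∷ xs) with P? (f x)
... | yes _ = cong (f x ∷_) (filter-map P? f xs)
... | no  _ = filter-map P? f xs

tabulate-+ : ∀ m {n} (g : Fin (m + n) → A) →
             tabulate g ≡ tabulate (g ∘ (_↑ˡ n)) ++ tabulate (g ∘ (m ↑ʳ_))
tabulate-+ zero    g = refl
tabulate-+ (suc m) g = cong (g zero ∷_) (tabulate-+ m (g ∘ suc))

-- The edges of the enlarged graph are the old ones followed by the new ones, so this computes its
-- `incidentEdges` in two parts.
filter-allFin-+ : ∀ m n {P : Fin (m + n) → Set} (P? : Decidable P) →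
  filter P? (allFin (m + n)) ≡
    map (_↑ˡ n) (filter (P? ∘ (_↑ˡ n)) (allFin m)) ++ map (m ↑ʳ_) (filter (P? ∘ (m ↑ʳ_)) (allFin n))
filter-allFin-+ m n P? = begin
  filter P? (allFin (m + n))
    ≡⟨ cong (filter P?) (tabulate-+ m id) ⟩
  filter P? (tabulate (_↑ˡ n) ++ tabulate (m ↑ʳ_))
    ≡⟨ filter-++ P? (tabulate (_↑ˡ n)) _ ⟩
  filter P? (tabulate (_↑ˡ n)) ++ filter P? (tabulate (m ↑ʳ_))
    ≡⟨ cong₂ (λ xs ys → filter P? xs ++ filter P? ys)
             (sym (map-tabulate id (_↑ˡ n))) (sym (map-tabulate id (m ↑ʳ_))) ⟩
  filter P? (map (_↑ˡ n) (allFin m)) ++ filter P? (map (m ↑ʳ_) (allFin n))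
    ≡⟨ cong₂ _++_ (filter-map P? (_↑ˡ n) (allFin m)) (filter-map P? (m ↑ʳ_) (allFin n)) ⟩
  map (_↑ˡ n) (filter (P? ∘ (_↑ˡ n)) (allFin m)) ++ map (m ↑ʳ_) (filter (P? ∘ (m ↑ʳ_)) (allFin n)) ∎
  where open ≡-Reasoning

filter-≟-allFin : ∀ {n} (i : Fin n) → filter (Fin._≟ i) (allFin n) ≡ [ i ]
filter-≟-allFin {suc n} zero =
  cong (zero ∷_) (filter-none (Fin._≟ zero) (All.tabulate⁺ {f = suc} λ _ ()))
filter-≟-allFin {suc n} (suc i) = begin
  filter (Fin._≟ suc i) (tabulate suc)        ≡⟨ cong (filter (Fin._≟ suc i)) (map-tabulate id suc) ⟨
  filter (Fin._≟ suc i) (map suc (allFin n))  ≡⟨ filter-map (Fin._≟ suc i) suc (allFin n) ⟩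
  map suc (filter (λ j → suc j Fin.≟ suc i) (allFin n))
    ≡⟨ cong (map suc) (filter-≐ _ (Fin._≟ i) ((λ { refl → refl }) , (λ { refl → refl })) (allFin n)) ⟩
  map suc (filter (Fin._≟ i) (allFin n))      ≡⟨ cong (map suc) (filter-≟-allFin i) ⟩
  [ suc i ]                                   ∎
  where open ≡-Reasoning

∑-tabulate : ∀ n (F : ℕ → ℕ) → ∑[1⋯ n ] F ≡ sum (tabulate {n = n} (F ∘ suc ∘ toℕ))
∑-tabulate zero    F = refl
∑-tabulate (suc n) F = cong (F 1 +_) (∑-tabulate n (F ∘ suc))

-- Each induction step peels off the first block of k indices. This links the sum over the new
-- edges, indexed by a single number, to the double sum of condition (b).
sum-remQuot : ∀ s k (F : Fin s × Fin k → ℕ) →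
  sum (tabulate (F ∘ remQuot {s} k)) ≡ sum (tabulate λ j → sum (tabulate λ i → F (j , i)))
sum-remQuot zero    k F = refl
sum-remQuot (suc s) k F = begin
  sum (tabulate (F ∘ remQuot {suc s} k))
    ≡⟨ cong sum (tabulate-+ k (F ∘ remQuot {suc s} k)) ⟩
  sum (tabulate (λ i → F (remQuot {suc s} k (i ↑ˡ (s * k))))
       ++ tabulate (λ a → F (remQuot {suc s} k (k ↑ʳ a))))
    ≡⟨ sum-++ (tabulate λ i → F (remQuot {suc s} k (i ↑ˡ (s * k)))) _ ⟩
  sum (tabulate (λ i → F (remQuot {suc s} k (i ↑ˡ (s * k)))))
    + sum (tabulate (λ a → F (remQuot {suc s} k (k ↑ʳ a))))
    ≡⟨ cong₂ (λ xs ys → sum xs + sum ys)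
         (tabulate-cong λ i → cong F (remQuot-combine {suc s} zero i))
         (tabulate-cong λ a → cong F (remQuot-↑ʳ a)) ⟩
  sum (tabulate (λ i → F (zero , i))) + sum (tabulate (F ∘ map₁ suc ∘ remQuot {s} k))
    ≡⟨ cong (sum (tabulate λ i → F (zero , i)) +_) (sum-remQuot s k (F ∘ map₁ suc)) ⟩
  sum (tabulate λ j → sum (tabulate λ i → F (j , i))) ∎
  where
  open ≡-Reasoning
  remQuot-↑ʳ : ∀ a → remQuot {suc s} k (k ↑ʳ a) ≡ map₁ suc (remQuot {s} k a)
  remQuot-↑ʳ a rewrite splitAt-↑ʳ k (s * k) a = refl

-- A view: matching on it rewrites an index of the enlarged graph, wherever it occurs in the goal,
-- to its old or new form.
data Split m n : Fin (m + n) → Set where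
  old : ∀ i → Split m n (i ↑ˡ n)
  new : ∀ j → Split m n (m ↑ʳ j)

split : ∀ m n i → Split m n i
split m n i with splitAt m i in eq
... | inj₁ j = subst (Split m n) (splitAt⁻¹-↑ˡ eq) (old j)
... | inj₂ j = subst (Split m n) (splitAt⁻¹-↑ʳ eq) (new j)

↑ˡ≢↑ʳ : ∀ {m n} (i : Fin m) (j : Fin n) → i ↑ˡ n ≢ m ↑ʳ j
↑ˡ≢↑ʳ {m} {n} i j eq
  with () ← trans (sym (splitAt-↑ˡ m i n)) (trans (cong (splitAt m) eq) (splitAt-↑ʳ m n j))

-- The cyclic shift, sending 0 to the last element and i + 1 to i. For m = 1 it would fix 0; this is
-- where ks ≥ 2 enters.
fixedPointFree : ∀ {m} → 2 ≤ m → Σ (Fin m ↔ Fin m) λ ρ → ∀ a → Inverse.to ρ a ≢ a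
fixedPointFree {suc (suc n)} (s≤s (s≤s _)) = ρ , ρ≢
  where
  ρ = insert zero (fromℕ (suc n)) Perm.id
  punchIn-fromℕ≢suc : ∀ {n} (a : Fin n) → punchIn (fromℕ n) a ≢ suc a
  punchIn-fromℕ≢suc (suc a) eq = punchIn-fromℕ≢suc a (Fin-suc-injective eq)
  ρ≢ : ∀ a → Inverse.to ρ a ≢ a
  -- At 0 the image is `fromℕ (suc n)`, a successor, so that case is absurd and has no clause.
  ρ≢ (suc a) eq =
    punchIn-fromℕ≢suc a (trans (sym (insert-punchIn zero (fromℕ (suc n)) Perm.id a)) eq)

-- Searching through labelings

-- Induction on the domain: choose the value at 0, then the rest. A function is only pointwise equal
-- to its decomposition into these, hence the congruence hypothesis on `P`.
anyFunction? : ∀ {m n} {P : (Fin m → Fin n) → Set} → (∀ {g g′} → g ≗ g′ → P g → P g′) →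
               Decidable P → Dec (∃ P)
anyFunction? {zero} resp P? =
  map′ (λ p → _ , p) (λ (g , p) → resp (λ ()) p) (P? λ ())
anyFunction? {suc m} {P = P} resp P? =
  map′ (λ (x , g , p) → (x ∷ᶠ g) , p)
       (λ (g , p) → g zero , g ∘ suc , resp (λ { zero → refl ; (suc _) → refl }) p)
       (any? λ x → anyFunction? (λ eq → resp λ { zero → refl ; (suc i) → eq i }) (λ g → P? (x ∷ᶠ g)))

all⊎? : ∀ {m n} {P : (Fin m ⊎ Fin n) → Set} → Decidable P → Dec (∀ x → P x)
all⊎? P? = map′ (λ { (p , q) (inj₁ i) → p i ; (p , q) (inj₂ j) → q j })
                (λ p → p ∘ inj₁ , p ∘ inj₂)
                (all? (P? ∘ inj₁) ×-dec all? (P? ∘ inj₂))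

any⊎? : ∀ {m n} {P : (Fin m ⊎ Fin n) → Set} → Decidable P → Dec (∃ P)
any⊎? P? = map′ (λ { (inj₁ (i , p)) → inj₁ i , p ; (inj₂ (j , p)) → inj₂ j , p })
                (λ { (inj₁ i , p) → inj₁ (i , p) ; (inj₂ j , p) → inj₂ (j , p) })
                (any? (P? ∘ inj₁) ⊎-dec any? (P? ∘ inj₂))

bijective? : ∀ {p q n} (g : Element p q → Fin n) → Dec (Bijective _≡_ _≡_ g)
bijective? g =
  -- Surjectivity is tested in its strict form, which asks for a single preimage and so can be
  -- searched.
  map′ (λ (inj , surj) → (λ {x} {y} → inj x y) , strictlySurjective⇒surjective surj)
       (λ (inj , surj) → (λ x y → inj) , λ y → map₂′ (λ h → h refl) (surj y))
       (all⊎? (λ x → all⊎? λ y → (g x Fin.≟ g y) →-dec Sum.≡-dec Fin._≟_ Fin._≟_ x y)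
        ×-dec all? λ y → any⊎? λ x → g x Fin.≟ y)
  where
  map₂′ : ∀ {C : Set} {P Q : C → Set} → (∀ {x} → P x → Q x) → ∃ P → ∃ Q
  map₂′ h (x , p) = x , h p

-- Labelings carry proofs and cannot be enumerated directly. The search runs over the underlying
-- functions, on vertices and on edges separately, and asks of each whether some labeling with
-- property `P` has it as underlying function.
anyLabeling? : ∀ {p q} {P : (Labeling p q) → Set} →
               (∀ {f f′} → Bijection.to f ≗ Bijection.to f′ → P f → P f′) →
               Decidable P → Dec (∃ P)
anyLabeling? {p} {q} {P} resp P? =
  map′ (λ (g₁ , g₂ , f , _ , Pf) → f , Pf)
       (λ (f , Pf) → Bijection.to f ∘ inj₁ , Bijection.to f ∘ inj₂ , f
                     , (λ { (inj₁ _) → refl ; (inj₂ _) → refl }) , Pf)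
       (anyFunction?
         (λ eq (g₂ , f , f≗ , Pf) → g₂ , f
           , (λ { (inj₁ u) → trans (f≗ (inj₁ u)) (eq u) ; (inj₂ e) → f≗ (inj₂ e) }) , Pf)
         λ g₁ → anyFunction?
           (λ eq (f , f≗ , Pf) → f
             , (λ { (inj₁ u) → f≗ (inj₁ u) ; (inj₂ e) → trans (f≗ (inj₂ e)) (eq e) }) , Pf)
           λ g₂ → realised? [ g₁ , g₂ ]′)
  where
  realised? : ∀ (g : Element p q → Fin (p + q)) →
              Dec (∃ λ f → (Bijection.to f ≗ g) × P f)
  realised? g with bijective? g
  ... | no ¬bij = no λ (f , f≗ , _) → ¬bij
        ( (λ {x} {y} eq → Bijection.injective f (trans (f≗ x) (trans eq (sym (f≗ y)))))
        , λ y → let x , fx≡ = Bijection.surjective f y in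
                x , λ { refl → trans (sym (f≗ x)) (fx≡ refl) })
  -- Labelings with the same function may differ in their proofs; `resp` carries `P` over to the one
  -- rebuilt from `bij`.
  ... | yes bij = map′ (λ Pf → mk⤖ bij , (λ _ → refl) , Pf)
                       (λ (f , f≗ , Pf) → resp f≗ Pf)
                       (P? (mk⤖ bij))

module _ {p q : ℕ} (G : Graph p q) where

  adjacent? : ∀ u w → Dec (Adjacent G u w)
  adjacent? u w = ¬? (u Fin.≟ w) ×-dec any? λ e → incident? G u e ×-dec incident? G w e

  adjacentEdges? : ∀ e e′ → Dec (AdjacentEdges G e e′)
  adjacentEdges? e e′ = ¬? (e Fin.≟ e′) ×-dec any? λ u → incident? G u e ×-dec incident? G u e′

  localTotalAntimagic? : ∀ f → Dec (LocalTotalAntimagic G f)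
  localTotalAntimagic? f =
    map′ (λ (a , b , c) → record { vertices≢ = a ; edges≢ = b ; incident≢ = c })
         (λ lta → let open LocalTotalAntimagic lta in vertices≢ , edges≢ , incident≢)
         ((all? λ u → all? λ w → adjacent? u w →-dec ¬? (_ ≟ _))
          ×-dec (all? λ e → all? λ e′ → adjacentEdges? e e′ →-dec ¬? (_ ≟ _))
          ×-dec (all? λ u → all? λ e → incident? G u e →-dec ¬? (_ ≟ _)))

  module _ {f f′ : Labeling p q} (f≗f′ : Bijection.to f ≗ Bijection.to f′) where

    weight-cong : weight G f ≗ weight G f′
    weight-cong (inj₁ u) =
      cong sum (map-cong (λ e → cong (suc ∘ toℕ) (f≗f′ (inj₂ e))) (incidentEdges G u))
    weight-cong (inj₂ e) =
      cong₂ (λ a b → suc (toℕ a) + suc (toℕ b)) (f≗f′ (inj₁ (src G e))) (f≗f′ (inj₁ (tgt G e)))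

    localTotalAntimagic-cong : LocalTotalAntimagic G f → LocalTotalAntimagic G f′
    localTotalAntimagic-cong lta = record
      { vertices≢ = λ u w a → transport (inj₁ u) (inj₁ w) (vertices≢ u w a)
      ; edges≢    = λ e e′ a → transport (inj₂ e) (inj₂ e′) (edges≢ e e′ a)
      ; incident≢ = λ u e a → transport (inj₁ u) (inj₂ e) (incident≢ u e a)
      }
      where
      open LocalTotalAntimagic lta
      transport : ∀ x y → weight G f x ≢ weight G f y → weight G f′ x ≢ weight G f′ y
      transport x y = subst₂ _≢_ (weight-cong x) (weight-cong y)

    #weights-cong : #weights G f ≡ #weights G f′
    #weights-cong = cong (length ∘ deduplicate _≟_) (map-cong weight-cong (elements p q))

  -- The set of weights and bounds on its size

  weightSet : Labeling p q → List ℕ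
  weightSet f = deduplicate _≟_ (map (weight G f) (elements p q))

  weight∈weightSet : ∀ f x → weight G f x ∈ weightSet f
  weight∈weightSet f x = ∈-deduplicate⁺ _≟_ (∈-map⁺ (weight G f) (∈-elements x))
    where
    ∈-elements : ∀ x → x ∈ elements p q
    ∈-elements (inj₁ u) = ∈-++⁺ˡ (∈-map⁺ inj₁ (∈-allFin u))
    ∈-elements (inj₂ e) = ∈-++⁺ʳ (map inj₁ (allFin p)) (∈-map⁺ inj₂ (∈-allFin e))

  -- Upper bounds come from exhibiting a list, repetitions allowed, that contains every weight.
  #weights≤ : ∀ f {ws} → (∀ x → weight G f x ∈ ws) → #weights G f ≤ length ws
  #weights≤ f {ws} cover = unique-⊆⇒length≤ _≟_ (deduplicate-! (map (weight G f) (elements p q)))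
    λ z∈ → let x , _ , z≡ = ∈-map⁻ (weight G f) (∈-deduplicate⁻ _≟_ _ z∈) in
           subst (_∈ ws) (sym z≡) (cover x)

  -- The edges at u have pairwise distinct weights, all different from that of u.
  deg+1≤#weights : ∀ u f → LocalTotalAntimagic G f → deg G u + 1 ≤ #weights G f
  deg+1≤#weights u f lta = begin
    deg G u + 1                ≡⟨ +-comm (deg G u) 1 ⟩
    suc (deg G u)              ≡⟨ cong suc (length-map (weight G f ∘ inj₂) (incidentEdges G u)) ⟨
    length (weight G f (inj₁ u) ∷ map (weight G f ∘ inj₂) (incidentEdges G u))
      ≤⟨ unique-⊆⇒length≤ _≟_ unique sub ⟩
    #weights G f               ∎
    where
    open ≤-Reasoning
    open LocalTotalAntimagic lta
    incident : ∀ {e} → e ∈ incidentEdges G u → Incident G u e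
    incident e∈ = proj₂ (∈-filter⁻ (incident? G u) {xs = allFin q} e∈)
    inj : ∀ {e e′} → e ∈ incidentEdges G u → e′ ∈ incidentEdges G u →
          weight G f (inj₂ e) ≡ weight G f (inj₂ e′) → e ≡ e′
    inj {e} {e′} e∈ e′∈ eq with e Fin.≟ e′
    ... | yes e≡e′ = e≡e′
    ... | no  e≢e′ =
      contradiction eq (edges≢ e e′ (e≢e′ , u , incident e∈ , incident e′∈))
    unique : Unique (weight G f (inj₁ u) ∷ map (weight G f ∘ inj₂) (incidentEdges G u))
    unique = All.map⁺ (All.tabulate λ e∈ → incident≢ u _ (incident e∈))
             ∷ unique-map⁺ inj (Unique.filter⁺ (incident? G u) (Unique.allFin⁺ q))
    sub : (weight G f (inj₁ u) ∷ map (weight G f ∘ inj₂) (incidentEdges G u)) ⊆ weightSet f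
    sub (here refl) = weight∈weightSet f (inj₁ u)
    sub (there z∈) with e , _ , refl ← ∈-map⁻ (weight G f ∘ inj₂) z∈ = weight∈weightSet f (inj₂ e)

  deg≤Δ : ∀ u → deg G u ≤ Δ G
  deg≤Δ u = All.lookup (xs≤max 0 (map (deg G) (allFin p))) (∈-map⁺ (deg G) (∈-allFin u))

  Δ≤ : ∀ {n} → (∀ u → deg G u ≤ n) → Δ G ≤ n
  Δ≤ h = max≤v⁺ z≤n (All.map⁺ (All.tabulate {xs = allFin p} λ {u} _ → h u))

  -- The minimum is c or c + 1, according to whether some labeling attains c. Producing it
  -- constructively means deciding that question, which the exhaustive search over labelings does.
  χlt-between : ∀ {c} → (∀ f → LocalTotalAntimagic G f → c ≤ #weights G f) →
                ∀ f → LocalTotalAntimagic G f → #weights G f ≤ suc c →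
                ∃ λ χ → χlt≡ G χ × c ≤ χ × χ ≤ suc c
  χlt-between {c} lower f lta upper
    with anyLabeling? {P = λ g → LocalTotalAntimagic G g × #weights G g ≡ c}
           (λ {g} {g′} eq (a , b) → localTotalAntimagic-cong {g} {g′} eq a
                                  , trans (sym (#weights-cong {g} {g′} eq)) b)
           (λ g → localTotalAntimagic? g ×-dec (#weights G g ≟ c))
  ... | yes best = c , (best , lower) , ≤-refl , n≤1+n c
  ... | no  none = suc c , ((f , lta , ≤-antisym upper (above f lta)) , above) , n≤1+n c , ≤-refl
    where
    above : ∀ g → LocalTotalAntimagic G g → suc c ≤ #weights G g
    above g ltag = ≤∧≢⇒< (lower g ltag) λ c≡ → none (g , ltag , sym c≡)

label≤ : ∀ {p q} (f : Labeling p q) x → label f x ≤ p + q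
label≤ f x = toℕ<n (Bijection.to f x)

-- Attaching pendant edges

module Attach {p q : ℕ} (G : Graph p q) (v : Fin p) (m : ℕ) where

  Gᵥ : Graph (p + m) (q + m)
  Gᵥ = attachPendants G v m

  src-old : ∀ e → src Gᵥ (e ↑ˡ m) ≡ src G e ↑ˡ m
  src-old e rewrite splitAt-↑ˡ q e m = refl

  tgt-old : ∀ e → tgt Gᵥ (e ↑ˡ m) ≡ tgt G e ↑ˡ m
  tgt-old e rewrite splitAt-↑ˡ q e m = refl

  src-new : ∀ a → src Gᵥ (q ↑ʳ a) ≡ v ↑ˡ m
  src-new a rewrite splitAt-↑ʳ q m a = refl

  tgt-new : ∀ a → tgt Gᵥ (q ↑ʳ a) ≡ p ↑ʳ a
  tgt-new a rewrite splitAt-↑ʳ q m a = refl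

  incident-old-old⁺ : ∀ {u e} → Incident G u e → Incident Gᵥ (u ↑ˡ m) (e ↑ˡ m)
  incident-old-old⁺ {e = e} (inj₁ refl) = inj₁ (src-old e)
  incident-old-old⁺ {e = e} (inj₂ refl) = inj₂ (tgt-old e)

  incident-old-old⁻ : ∀ {u e} → Incident Gᵥ (u ↑ˡ m) (e ↑ˡ m) → Incident G u e
  incident-old-old⁻ {e = e} (inj₁ eq) = inj₁ (↑ˡ-injective m _ _ (trans (sym (src-old e)) eq))
  incident-old-old⁻ {e = e} (inj₂ eq) = inj₂ (↑ˡ-injective m _ _ (trans (sym (tgt-old e)) eq))

  incident-old-new⁻ : ∀ {u a} → Incident Gᵥ (u ↑ˡ m) (q ↑ʳ a) → u ≡ v
  incident-old-new⁻ {a = a} (inj₁ eq) = ↑ˡ-injective m _ _ (trans (sym eq) (src-new a))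
  incident-old-new⁻ {a = a} (inj₂ eq) =
    contradiction (trans (sym eq) (tgt-new a)) (↑ˡ≢↑ʳ _ a)

  incident-new-old⁻ : ∀ {a e} → ¬ Incident Gᵥ (p ↑ʳ a) (e ↑ˡ m)
  incident-new-old⁻ {e = e} (inj₁ eq) = ↑ˡ≢↑ʳ _ _ (trans (sym (src-old e)) eq)
  incident-new-old⁻ {e = e} (inj₂ eq) = ↑ˡ≢↑ʳ _ _ (trans (sym (tgt-old e)) eq)

  incident-new-new⁻ : ∀ {a b} → Incident Gᵥ (p ↑ʳ a) (q ↑ʳ b) → b ≡ a
  incident-new-new⁻ {b = b} (inj₁ eq) = contradiction (trans (sym (src-new b)) eq) (↑ˡ≢↑ʳ _ _)
  incident-new-new⁻ {b = b} (inj₂ eq) = ↑ʳ-injective p _ _ (trans (sym (tgt-new b)) eq)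

  incidentEdges-≢ : ∀ {u} → u ≢ v →
                    incidentEdges Gᵥ (u ↑ˡ m) ≡ map (_↑ˡ m) (incidentEdges G u)
  incidentEdges-≢ {u} u≢v = begin
    incidentEdges Gᵥ (u ↑ˡ m)
      ≡⟨ filter-allFin-+ q m (incident? Gᵥ (u ↑ˡ m)) ⟩
    _ ≡⟨ cong₂ (λ es as → map (_↑ˡ m) es ++ map (q ↑ʳ_) as)
           (filter-≐ _ (incident? G u) (incident-old-old⁻ , incident-old-old⁺) (allFin q))
           (filter-none _ {xs = allFin m} (All.tabulate λ _ → u≢v ∘ incident-old-new⁻)) ⟩
    map (_↑ˡ m) (incidentEdges G u) ++ []
      ≡⟨ ++-identityʳ _ ⟩
    map (_↑ˡ m) (incidentEdges G u) ∎
    where open ≡-Reasoning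

  incidentEdges-v : incidentEdges Gᵥ (v ↑ˡ m) ≡
                    map (_↑ˡ m) (incidentEdges G v) ++ map (q ↑ʳ_) (allFin m)
  incidentEdges-v = trans (filter-allFin-+ q m (incident? Gᵥ (v ↑ˡ m)))
    (cong₂ (λ es as → map (_↑ˡ m) es ++ map (q ↑ʳ_) as)
      (filter-≐ _ (incident? G v) (incident-old-old⁻ , incident-old-old⁺) (allFin q))
      (filter-all _ {xs = allFin m} (All.tabulate λ {a} _ → inj₁ (src-new a))))

  incidentEdges-new : ∀ a → incidentEdges Gᵥ (p ↑ʳ a) ≡ [ q ↑ʳ a ]
  incidentEdges-new a = trans (filter-allFin-+ q m (incident? Gᵥ (p ↑ʳ a)))
    (cong₂ (λ es as → map (_↑ˡ m) es ++ map (q ↑ʳ_) as)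
      (filter-none _ {xs = allFin q} (All.tabulate λ _ → incident-new-old⁻))
      (trans (filter-≐ _ (Fin._≟ a)
               (incident-new-new⁻ , (λ { {b} refl → inj₂ (tgt-new b) })) (allFin m))
             (filter-≟-allFin a)))

  deg-v : deg Gᵥ (v ↑ˡ m) ≡ deg G v + m
  deg-v = begin
    deg Gᵥ (v ↑ˡ m)
      ≡⟨ cong length incidentEdges-v ⟩
    length (map (_↑ˡ m) (incidentEdges G v) ++ map (q ↑ʳ_) (allFin m))
      ≡⟨ length-++ (map (_↑ˡ m) (incidentEdges G v)) ⟩
    length (map (_↑ˡ m) (incidentEdges G v)) + length (map (q ↑ʳ_) (allFin m))
      ≡⟨ cong₂ _+_ (length-map (_↑ˡ m) (incidentEdges G v))
                   (trans (length-map (q ↑ʳ_) (allFin m)) (length-tabulate id)) ⟩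
    deg G v + m ∎
    where open ≡-Reasoning

  -- Among the old vertices only `v` gains degree, and it already had the maximum. The new vertices
  -- have degree 1, which m ≥ 1 keeps below the bound.
  Δ-attach : deg G v ≡ Δ G → 1 ≤ m → Δ Gᵥ ≡ Δ G + m
  Δ-attach v-max 1≤m = ≤-antisym (Δ≤ Gᵥ deg≤) (begin
    Δ G + m          ≡⟨ cong (_+ m) v-max ⟨
    deg G v + m      ≡⟨ deg-v ⟨
    deg Gᵥ (v ↑ˡ m)  ≤⟨ deg≤Δ Gᵥ (v ↑ˡ m) ⟩
    Δ Gᵥ             ∎)
    where
    open ≤-Reasoning
    deg≤ : ∀ u → deg Gᵥ u ≤ Δ G + m
    deg≤ u with split p m u
    ... | new a = begin
      deg Gᵥ (p ↑ʳ a)  ≡⟨ cong length (incidentEdges-new a) ⟩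
      1                ≤⟨ 1≤m ⟩
      m                ≤⟨ m≤n+m m (Δ G) ⟩
      Δ G + m          ∎
    ... | old u with u Fin.≟ v
    ...   | yes refl = begin
      deg Gᵥ (v ↑ˡ m)  ≡⟨ deg-v ⟩
      deg G v + m      ≡⟨ cong (_+ m) v-max ⟩
      Δ G + m          ∎
    ...   | no u≢v = begin
      deg Gᵥ (u ↑ˡ m)                           ≡⟨ cong length (incidentEdges-≢ u≢v) ⟩
      length (map (_↑ˡ m) (incidentEdges G u))  ≡⟨ length-map (_↑ˡ m) (incidentEdges G u) ⟩
      deg G u                                   ≤⟨ deg≤Δ G u ⟩
      Δ G                                       ≤⟨ m≤m+n (Δ G) m ⟩
      Δ G + m                                   ∎

  -- S a is the label of the a-th new edge, hence the weight of the a-th new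
  -- vertex; S (ρ a) is the weight of the a-th new edge.
  module Extension
    (f : Labeling p q) (f⁺ : Labeling (p + m) (q + m)) (S : Fin m → ℕ) (ρ : Fin m → Fin m)
    (label-oldV : ∀ u → label f⁺ (inj₁ (u ↑ˡ m)) ≡ label f (inj₁ u))
    (label-oldE : ∀ e → label f⁺ (inj₂ (e ↑ˡ m)) ≡ label f (inj₂ e))
    (label-newE : ∀ a → label f⁺ (inj₂ (q ↑ʳ a)) ≡ S a)
    (label-newV : ∀ a → label f (inj₁ v) + label f⁺ (inj₁ (p ↑ʳ a)) ≡ S (ρ a))
    where

    w = weight G f
    w⁺ = weight Gᵥ f⁺

    ΣS : ℕ
    ΣS = sum (map S (allFin m))

    labels-oldE : ∀ es → map (label f⁺ ∘ inj₂) (map (_↑ˡ m) es) ≡ map (label f ∘ inj₂) es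
    labels-oldE es = trans (sym (map-∘ es)) (map-cong label-oldE es)

    weight-≢ : ∀ {u} → u ≢ v → w⁺ (inj₁ (u ↑ˡ m)) ≡ w (inj₁ u)
    weight-≢ {u} u≢v = cong sum
      (trans (cong (map (label f⁺ ∘ inj₂)) (incidentEdges-≢ u≢v)) (labels-oldE (incidentEdges G u)))

    weight-v : w⁺ (inj₁ (v ↑ˡ m)) ≡ w (inj₁ v) + ΣS
    weight-v = begin
      sum (map L (incidentEdges Gᵥ (v ↑ˡ m)))
        ≡⟨ cong (sum ∘ map L) incidentEdges-v ⟩
      sum (map L (map (_↑ˡ m) es ++ map (q ↑ʳ_) (allFin m)))
        ≡⟨ cong sum (map-++ L (map (_↑ˡ m) es) _) ⟩
      sum (map L (map (_↑ˡ m) es) ++ map L (map (q ↑ʳ_) (allFin m)))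
        ≡⟨ sum-++ (map L (map (_↑ˡ m) es)) _ ⟩
      sum (map L (map (_↑ˡ m) es)) + sum (map L (map (q ↑ʳ_) (allFin m)))
        ≡⟨ cong₂ (λ xs ys → sum xs + sum ys)
             (labels-oldE es) (trans (sym (map-∘ (allFin m))) (map-cong label-newE (allFin m))) ⟩
      w (inj₁ v) + ΣS ∎
      where
      open ≡-Reasoning
      L = label f⁺ ∘ inj₂
      es = incidentEdges G v

    weight-newV : ∀ a → w⁺ (inj₁ (p ↑ʳ a)) ≡ S a
    weight-newV a = begin
      sum (map (label f⁺ ∘ inj₂) (incidentEdges Gᵥ (p ↑ʳ a)))
        ≡⟨ cong (sum ∘ map (label f⁺ ∘ inj₂)) (incidentEdges-new a) ⟩
      label f⁺ (inj₂ (q ↑ʳ a)) + 0  ≡⟨ +-identityʳ _ ⟩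
      label f⁺ (inj₂ (q ↑ʳ a))      ≡⟨ label-newE a ⟩
      S a                           ∎
      where open ≡-Reasoning

    weight-oldE : ∀ e → w⁺ (inj₂ (e ↑ˡ m)) ≡ w (inj₂ e)
    weight-oldE e = cong₂ _+_
      (trans (cong (label f⁺ ∘ inj₁) (src-old e)) (label-oldV (src G e)))
      (trans (cong (label f⁺ ∘ inj₁) (tgt-old e)) (label-oldV (tgt G e)))

    weight-newE : ∀ a → w⁺ (inj₂ (q ↑ʳ a)) ≡ S (ρ a)
    weight-newE a = trans
      (cong₂ _+_ (trans (cong (label f⁺ ∘ inj₁) (src-new a)) (label-oldV v))
                 (cong (label f⁺ ∘ inj₁) (tgt-new a)))
      (label-newV a)

    -- Around `v` the weights are ordered: old edges, then all values of `S`, then `v` itself.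
    -- Indeed an old edge at `v` weighs at most p + q + f(v), and the new weight of `v` is ΣS plus
    -- something positive. What remains is `v` against its old neighbours, excluded by (b); a new
    -- vertex against its edge, separated because `ρ` has no fixed point; new edges against each
    -- other, separated by injectivity; and pairs with unchanged weights, settled by `lta`.
    extension-lta :
      LocalTotalAntimagic G f →
      (∀ {a b} → S a ≡ S b → a ≡ b) → (∀ {a b} → ρ a ≡ ρ b → a ≡ b) → (∀ a → ρ a ≢ a) →
      (∀ a → p + q + label f (inj₁ v) < S a) →
      Fin m → 0 < w (inj₁ v) →
      (∀ x → Adjacent G v x → w (inj₁ v) + ΣS ≢ w (inj₁ x)) →
      LocalTotalAntimagic Gᵥ f⁺
    extension-lta lta S-inj ρ-inj ρ-free S-large a₀ w>0 condition-b = record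
      { vertices≢ = vertices≢⁺ ; edges≢ = edges≢⁺ ; incident≢ = incident≢⁺ }
      where
      open LocalTotalAntimagic lta

      S<weight-v : ∀ a → S a < w⁺ (inj₁ (v ↑ˡ m))
      S<weight-v a = begin-strict
        S a                    ≤⟨ x∈xs⇒x≤sum (∈-map⁺ S (∈-allFin a)) ⟩
        ΣS                     <⟨ m<n+m ΣS w>0 ⟩
        w (inj₁ v) + ΣS        ≡⟨ weight-v ⟨
        w⁺ (inj₁ (v ↑ˡ m))     ∎
        where open ≤-Reasoning

      oldE<S : ∀ {e} → Incident G v e → ∀ a → w⁺ (inj₂ (e ↑ˡ m)) < S a
      oldE<S {e} inc a = ≤-<-trans (≤-trans (≤-reflexive (weight-oldE e)) (bound inc)) (S-large a)
        where
        bound : Incident G v e → w (inj₂ e) ≤ p + q + label f (inj₁ v)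
        bound (inj₁ refl) = ≤-trans (≤-reflexive (+-comm (label f (inj₁ v)) _))
                                    (+-monoˡ-≤ (label f (inj₁ v)) (label≤ f _))
        bound (inj₂ refl) = +-monoˡ-≤ (label f (inj₁ v)) (label≤ f _)

      adjacent-old⁻ : ∀ {u x} → Adjacent Gᵥ (u ↑ˡ m) (x ↑ˡ m) → Adjacent G u x
      adjacent-old⁻ (u≢x , e , i₁ , i₂) with split q m e
      ... | old e = u≢x ∘ cong (_↑ˡ m) , e , incident-old-old⁻ i₁ , incident-old-old⁻ i₂
      -- A new edge meets the old vertices only in `v`, so the two vertices would coincide.
      ... | new a = contradiction
        (cong (_↑ˡ m) (trans (incident-old-new⁻ i₁) (sym (incident-old-new⁻ i₂)))) u≢x

      adjacent-old-new⁻ : ∀ {u a} → Adjacent Gᵥ (u ↑ˡ m) (p ↑ʳ a) → u ≡ v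
      adjacent-old-new⁻ (_ , e , i₁ , i₂) with split q m e
      ... | old e = contradiction i₂ incident-new-old⁻
      ... | new a = incident-old-new⁻ i₁

      adjacent-new⁻ : ∀ {a b} → ¬ Adjacent Gᵥ (p ↑ʳ a) (p ↑ʳ b)
      adjacent-new⁻ (a≢b , e , i₁ , i₂) with split q m e
      ... | old e = incident-new-old⁻ i₁
      ... | new c = a≢b (cong (p ↑ʳ_) (trans (sym (incident-new-new⁻ i₁)) (incident-new-new⁻ i₂)))

      adjacent-sym : ∀ {u x} → Adjacent Gᵥ u x → Adjacent Gᵥ x u
      adjacent-sym (u≢x , e , i₁ , i₂) = ≢-sym u≢x , e , i₂ , i₁

      weight-v≢newV : ∀ {u a} → Adjacent Gᵥ (u ↑ˡ m) (p ↑ʳ a) →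
                      w⁺ (inj₁ (u ↑ˡ m)) ≢ w⁺ (inj₁ (p ↑ʳ a))
      weight-v≢newV {a = a} adj eq with refl ← adjacent-old-new⁻ adj =
        <⇒≢ (S<weight-v a) (trans (sym (weight-newV a)) (sym eq))

      weight-v≢ : ∀ {x} → Adjacent Gᵥ (v ↑ˡ m) (x ↑ˡ m) →
                  w⁺ (inj₁ (v ↑ˡ m)) ≢ w⁺ (inj₁ (x ↑ˡ m))
      weight-v≢ {x} adj eq =
        condition-b x (adjacent-old⁻ adj) (trans (sym weight-v) (trans eq (weight-≢ x≢v)))
        where
        x≢v : x ≢ v
        x≢v refl = proj₁ adj refl

      vertices≢⁺ : ∀ u x → Adjacent Gᵥ u x → w⁺ (inj₁ u) ≢ w⁺ (inj₁ x)
      vertices≢⁺ u x adj with split p m u | split p m x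
      ... | new a | new b = contradiction adj adjacent-new⁻
      ... | old u | new b = weight-v≢newV adj
      ... | new a | old x = ≢-sym (weight-v≢newV (adjacent-sym adj))
      ... | old u | old x with u Fin.≟ v | x Fin.≟ v
      ...   | yes refl | _        = weight-v≢ adj
      ...   | no _     | yes refl = ≢-sym (weight-v≢ (adjacent-sym adj))
      ...   | no u≢v   | no x≢v   =
        subst₂ _≢_ (sym (weight-≢ u≢v)) (sym (weight-≢ x≢v)) (vertices≢ u x (adjacent-old⁻ adj))

      adjacentEdges-old⁻ : ∀ {e e′} → AdjacentEdges Gᵥ (e ↑ˡ m) (e′ ↑ˡ m) → AdjacentEdges G e e′
      adjacentEdges-old⁻ (e≢e′ , u , i₁ , i₂) with split p m u
      ... | old u = e≢e′ ∘ cong (_↑ˡ m) , u , incident-old-old⁻ i₁ , incident-old-old⁻ i₂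
      ... | new a = contradiction i₁ incident-new-old⁻

      weight-oldE≢newE : ∀ {u e a} → Incident Gᵥ u (e ↑ˡ m) → Incident Gᵥ u (q ↑ʳ a) →
                         w⁺ (inj₂ (e ↑ˡ m)) ≢ w⁺ (inj₂ (q ↑ʳ a))
      weight-oldE≢newE {u} {e} {a} i₁ i₂ eq with split p m u
      ... | new b = incident-new-old⁻ i₁
      ... | old u with refl ← incident-old-new⁻ i₂ =
        <⇒≢ (oldE<S (incident-old-old⁻ i₁) (ρ a)) (trans eq (weight-newE a))

      edges≢⁺ : ∀ e e′ → AdjacentEdges Gᵥ e e′ → w⁺ (inj₂ e) ≢ w⁺ (inj₂ e′)
      edges≢⁺ e e′ adj@(e≢e′ , u , i₁ , i₂) with split q m e | split q m e′
      ... | old e | old e′ =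
        subst₂ _≢_ (sym (weight-oldE e)) (sym (weight-oldE e′)) (edges≢ e e′ (adjacentEdges-old⁻ adj))
      ... | old e | new b = weight-oldE≢newE i₁ i₂
      ... | new a | old e′ = ≢-sym (weight-oldE≢newE i₂ i₁)
      ... | new a | new b = λ eq → e≢e′ (cong (q ↑ʳ_)
        (ρ-inj (S-inj (trans (sym (weight-newE a)) (trans eq (weight-newE b))))))

      incident≢⁺ : ∀ u e → Incident Gᵥ u e → w⁺ (inj₁ u) ≢ w⁺ (inj₂ e)
      incident≢⁺ u e inc eq with split p m u | split q m e
      ... | new a | old e = incident-new-old⁻ inc
      ... | new a | new b with refl ← incident-new-new⁻ inc =
        ρ-free a (S-inj (trans (sym (weight-newE a)) (trans (sym eq) (weight-newV a))))
      ... | old u | new b with refl ← incident-old-new⁻ inc =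
        <⇒≢ (S<weight-v (ρ b)) (trans (sym (weight-newE b)) (sym eq))
      ... | old u | old e with u Fin.≟ v
      -- Any value of `S` separates the old edge from `v`; `a₀` supplies one.
      ...   | yes refl = <⇒≢ (<-trans (oldE<S (incident-old-old⁻ inc) a₀) (S<weight-v a₀)) (sym eq)
      ...   | no u≢v =
        incident≢ u e (incident-old-old⁻ inc) (trans (sym (weight-≢ u≢v)) (trans eq (weight-oldE e)))

    newWeights : List ℕ
    newWeights = w (inj₁ v) + ΣS ∷ map S (allFin m)

    newWeights-length : length newWeights ≡ suc m
    newWeights-length = cong suc (trans (length-map S (allFin m)) (length-tabulate id))

    S∈newWeights : ∀ a → S a ∈ newWeights
    S∈newWeights a = there (∈-map⁺ S (∈-allFin a))

    -- Old elements other than `v` keep their weights. Recording `y ≢ inj₁ v` is what later allows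
    -- the old weight of `v` to drop out of the count.
    weight-cases : ∀ x → w⁺ x ∈ newWeights ⊎ (∃ λ y → y ≢ inj₁ v × w⁺ x ≡ w y)
    weight-cases (inj₁ u) with split p m u
    ... | new a = inj₁ (subst (_∈ newWeights) (sym (weight-newV a)) (S∈newWeights a))
    ... | old u with u Fin.≟ v
    ...   | yes refl = inj₁ (here weight-v)
    ...   | no u≢v = inj₂ (inj₁ u , u≢v ∘ inj₁-injective , weight-≢ u≢v)
    weight-cases (inj₂ e) with split q m e
    ... | new a = inj₁ (subst (_∈ newWeights) (sym (weight-newE a)) (S∈newWeights (ρ a)))
    ... | old e = inj₂ (inj₂ e , (λ ()) , weight-oldE e)

    #weights-extension : #weights Gᵥ f⁺ ≤ suc m + #weights G f
    #weights-extension = begin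
      #weights Gᵥ f⁺                           ≤⟨ #weights≤ Gᵥ f⁺ cover ⟩
      length (newWeights ++ weightSet G f)     ≡⟨ length-++ newWeights ⟩
      length newWeights + #weights G f         ≡⟨ cong (_+ #weights G f) newWeights-length ⟩
      suc m + #weights G f                     ∎
      where
      open ≤-Reasoning
      cover : ∀ x → w⁺ x ∈ newWeights ++ weightSet G f
      cover x with weight-cases x
      ... | inj₁ x∈ = ∈-++⁺ˡ x∈
      ... | inj₂ (y , _ , eq) =
        ∈-++⁺ʳ newWeights (subst (_∈ weightSet G f) (sym eq) (weight∈weightSet G f y))

    -- One old weight is struck from the covering list. This is allowed if only `v` had it, since
    -- `v` changes its weight, or if it is among the new weights anyway; `redundant` covers both
    -- alternatives of (c).
    #weights-extension-tight :
      ∀ x₀ → (∀ y → y ≢ inj₁ v → w y ≡ w x₀ → w x₀ ∈ newWeights) →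
      #weights Gᵥ f⁺ ≤ m + #weights G f
    #weights-extension-tight x₀ redundant = begin
      #weights Gᵥ f⁺                       ≤⟨ #weights≤ Gᵥ f⁺ cover ⟩
      length (newWeights ++ rest)          ≡⟨ length-++ newWeights ⟩
      length newWeights + length rest      ≡⟨ cong (_+ length rest) newWeights-length ⟩
      suc m + length rest                  ≡⟨ +-suc m (length rest) ⟨
      m + suc (length rest)
        ≤⟨ +-monoʳ-≤ m (length-filter-≢ _≟_ (weight∈weightSet G f x₀)) ⟩
      m + #weights G f                     ∎
      where
      open ≤-Reasoning
      rest = filter (λ z → ¬? (z ≟ w x₀)) (weightSet G f)
      cover : ∀ x → w⁺ x ∈ newWeights ++ rest
      cover x with weight-cases x
      ... | inj₁ x∈ = ∈-++⁺ˡ x∈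
      ... | inj₂ (y , y≢v , eq) with w y ≟ w x₀
      ...   | yes wy≡ = ∈-++⁺ˡ (subst (_∈ newWeights) (sym (trans eq wy≡)) (redundant y y≢v wy≡))
      ...   | no  wy≢ = ∈-++⁺ʳ newWeights (subst (_∈ rest) (sym eq)
        (∈-filter⁺ (λ z → ¬? (z ≟ w x₀)) (weight∈weightSet G f y) wy≢))

-- The labels of the new vertices and edges

-- The 2 s k positions form s blocks of 2 k; vertices occupy the lower and edges
-- the upper half of each block.  The vertices are rotated because, for odd k,
-- the middle vertex of a block would otherwise share its weight with its edge.
module Blocks (s k : ℕ) (2≤sk : 2 ≤ s * k) where

  private
    m = s * k

  ρ : Fin m ↔ Fin m
  ρ = proj₁ (fixedPointFree 2≤sk)

  -- The offset is reversed because the terms p + q + 2jk + 1 - i of condition (b) run downwards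
  -- through the upper half of block j.
  cell : Fin m ↔ (Fin s × Fin k)
  cell = (↔-id (Fin s) ×-↔ reverse) ↔-∘ *↔×

  -- Here `inj₁` stands for the new vertices and `inj₂` for the new edges. A position consists of a
  -- block, a half of it and an offset; vertex `a` takes the block and offset of edge `ρ a`.
  position : (Fin m ⊎ Fin m) ↔ Fin (s * (k + k))
  position = ↔-sym *↔× ↔-∘ ((↔-id (Fin s) ×-↔ ↔-sym +↔⊎)
             ↔-∘ (↔-sym ×-distribˡ-⊎ ↔-∘ ((cell ↔-∘ ρ) ⊎-↔ cell)))

  position-edge : ∀ a → let j , i = Inverse.to cell a in
    toℕ (Inverse.to position (inj₂ a)) ≡ (k + k) * toℕ j + (k + toℕ i)
  position-edge a = let j , i = Inverse.to cell a in
    trans (toℕ-combine j (k ↑ʳ i)) (cong ((k + k) * toℕ j +_) (toℕ-↑ʳ k i))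

  -- The halves of a block lie k apart, and k is the label of `v`. So the new edge at vertex `a`
  -- weighs as much as the label of edge `ρ a`.
  position-vertex : ∀ a → k + toℕ (Inverse.to position (inj₁ a)) ≡
                          toℕ (Inverse.to position (inj₂ (Inverse.to ρ a)))
  position-vertex a = let j , i = Inverse.to cell (Inverse.to ρ a) in begin
    k + toℕ (combine j (i ↑ˡ k))       ≡⟨ cong (k +_) (toℕ-combine j (i ↑ˡ k)) ⟩
    k + ((k + k) * toℕ j + toℕ (i ↑ˡ k))
      ≡⟨ cong (λ x → k + ((k + k) * toℕ j + x)) (toℕ-↑ˡ i k) ⟩
    k + ((k + k) * toℕ j + toℕ i)      ≡⟨ swap-summands k ((k + k) * toℕ j) (toℕ i) ⟩
    (k + k) * toℕ j + (k + toℕ i)      ≡⟨ position-edge (Inverse.to ρ a) ⟨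
    toℕ (Inverse.to position (inj₂ (Inverse.to ρ a))) ∎
    where
    open ≡-Reasoning
    swap-summands : ∀ x y z → x + (y + z) ≡ y + (x + z)
    swap-summands = solve-∀

-- The enlarged graph lists old and new vertices, then old and new edges, whereas labels are
-- assigned to the old elements first and then to the new ones.
shuffle : ∀ {A B C D : Set} → ((A ⊎ B) ⊎ (C ⊎ D)) ↔ ((A ⊎ C) ⊎ (B ⊎ D))
shuffle = mk↔ₛ′ to to invol invol
  where
  to : ∀ {A B C D : Set} → ((A ⊎ B) ⊎ (C ⊎ D)) → ((A ⊎ C) ⊎ (B ⊎ D))
  to (inj₁ (inj₁ a)) = inj₁ (inj₁ a)
  to (inj₁ (inj₂ b)) = inj₂ (inj₁ b)
  to (inj₂ (inj₁ c)) = inj₁ (inj₂ c)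
  to (inj₂ (inj₂ d)) = inj₂ (inj₂ d)
  invol : ∀ {A B C D : Set} (x : (A ⊎ B) ⊎ (C ⊎ D)) → to (to x) ≡ x
  invol (inj₁ (inj₁ _)) = refl
  invol (inj₁ (inj₂ _)) = refl
  invol (inj₂ (inj₁ _)) = refl
  invol (inj₂ (inj₂ _)) = refl

module ExtendLabeling {p q m n : ℕ} (f : Labeling p q) (h : (Fin m ⊎ Fin m) ↔ Fin n)
                      (size : (p + q) + n ≡ (p + m) + (q + m)) where

  extend : Labeling (p + m) (q + m)
  extend = ↔⇒⤖ (cast-id size ↔-∘ ↔-sym +↔⊎)
           ⤖-∘ ((f ⊎-⤖ ↔⇒⤖ h) ⤖-∘ ↔⇒⤖ (shuffle ↔-∘ (+↔⊎ ⊎-↔ +↔⊎)))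

  extend-oldV : ∀ u → label extend (inj₁ (u ↑ˡ m)) ≡ label f (inj₁ u)
  extend-oldV u rewrite splitAt-↑ˡ p u m =
    cong suc (trans (toℕ-cast size _) (toℕ-↑ˡ (Bijection.to f (inj₁ u)) n))

  extend-oldE : ∀ e → label extend (inj₂ (e ↑ˡ m)) ≡ label f (inj₂ e)
  extend-oldE e rewrite splitAt-↑ˡ q e m =
    cong suc (trans (toℕ-cast size _) (toℕ-↑ˡ (Bijection.to f (inj₂ e)) n))

  extend-newV : ∀ a → label extend (inj₁ (p ↑ʳ a)) ≡ suc (p + q + toℕ (Inverse.to h (inj₁ a)))
  extend-newV a rewrite splitAt-↑ʳ p m a =
    cong suc (trans (toℕ-cast size _) (toℕ-↑ʳ (p + q) (Inverse.to h (inj₁ a))))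

  extend-newE : ∀ a → label extend (inj₂ (q ↑ʳ a)) ≡ suc (p + q + toℕ (Inverse.to h (inj₂ a)))
  extend-newE a rewrite splitAt-↑ʳ q m a =
    cong suc (trans (toℕ-cast size _) (toℕ-↑ʳ (p + q) (Inverse.to h (inj₂ a))))

-- Combining the bounds

weight-positive : ∀ {p q} (G : Graph p q) (f : Labeling p q) {u e} →
                  Incident G u e → 0 < weight G f (inj₁ u)
weight-positive G f {u} {e} inc = ≤-trans (s≤s z≤n)
  (x∈xs⇒x≤sum (∈-map⁺ (label f ∘ inj₂) (∈-filter⁺ (incident? G u) (∈-allFin e) inc)))

-- The block coordinates come from `remQuot` on `Fin (s * k)`, while the theorem attaches `k * s`
-- edges. As the graph's type depends on this number, it is a variable `m` whose equation is matched
-- with `refl`, which avoids transporting graphs.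
attachBlocks :
  ∀ (k s : ℕ) → 2 ≤ s * k → ∀ {m} → m ≡ s * k →
  ∀ {p q : ℕ} (G : Graph p q) → Admissible G →
  ∀ (v : Fin p) (f : Labeling p q) →
  LocalTotalAntimagic G f → #weights G f ≡ Δ G + 1 →
  deg G v ≡ Δ G → label f (inj₁ v) ≡ k →
  (∀ (x : Fin p) → Adjacent G v x →
    weight G f (inj₁ v)
      + ∑[1⋯ s ] (λ j → ∑[1⋯ k ] (λ i → (p + q + 2 * j * k + 1) ∸ i))
    ≢ weight G f (inj₁ x)) →
  let Gᵥ = attachPendants G v m in
  (∃ λ χ → χlt≡ Gᵥ χ × Δ Gᵥ + 1 ≤ χ × χ ≤ Δ Gᵥ + 2)
  ×
  ( ( (∀ (y : Element p q) → weight G f y ≡ weight G f (inj₁ v) → y ≡ inj₁ v)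
    ⊎ (Σ (Element p q) λ y → ∃ λ j → ∃ λ i →
        1 ≤ j × j ≤ s × 1 ≤ i × i ≤ k
        × weight G f y ≡ p + q + (2 * j ∸ 1) * k + i))
    → χlt≡ Gᵥ (Δ Gᵥ + 1))
attachBlocks k s 2≤sk {m} refl {p} {q} G admissible v f lta #f≡ v-max fv≡k condition-b =
  between , attained
  where
  open Blocks s k 2≤sk
  open Attach G v m

  size : ∀ p q s k → (p + q) + s * (k + k) ≡ (p + s * k) + (q + s * k)
  size = solve-∀

  open ExtendLabeling f position (size p q s k)

  S : Fin m → ℕ
  S a = suc (p + q + toℕ (Inverse.to position (inj₂ a)))

  label-newV : ∀ a → label f (inj₁ v) + label extend (inj₁ (p ↑ʳ a)) ≡ S (Inverse.to ρ a)
  label-newV a = begin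
    label f (inj₁ v) + label extend (inj₁ (p ↑ʳ a)) ≡⟨ cong₂ _+_ fv≡k (extend-newV a) ⟩
    k + suc (p + q + x)                             ≡⟨ move k (p + q) x ⟩
    suc (p + q + (k + x))                           ≡⟨ cong (λ y → suc (p + q + y)) (position-vertex a) ⟩
    S (Inverse.to ρ a)                              ∎
    where
    open ≡-Reasoning
    x = toℕ (Inverse.to position (inj₁ a))
    move : ∀ k n x → k + suc (n + x) ≡ suc (n + (k + x))
    move = solve-∀

  open Extension f extend S (Inverse.to ρ) extend-oldV extend-oldE extend-newE label-newV

  S-injective : ∀ {a b} → S a ≡ S b → a ≡ b
  S-injective = inj₂-injective ∘ Bijection.injective (↔⇒⤖ position)
              ∘ toℕ-injective ∘ +-cancelˡ-≡ (suc (p + q)) _ _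

  -- New edges skip the lower half of the first block, so their labels start at p + q + k + 1.
  S-large : ∀ a → p + q + label f (inj₁ v) < S a
  S-large a = s≤s (+-monoʳ-≤ (p + q) (begin
    label f (inj₁ v)                                ≡⟨ fv≡k ⟩
    k                                               ≤⟨ m≤m+n k _ ⟩
    k + toℕ (proj₂ (Inverse.to cell a))             ≤⟨ m≤n+m _ ((k + k) * toℕ (proj₁ (Inverse.to cell a))) ⟩
    _                                               ≡⟨ position-edge a ⟨
    toℕ (Inverse.to position (inj₂ a))              ∎))
    where open ≤-Reasoning

  -- The summand of condition (b), with both indices counted from 0.
  term : Fin s × Fin k → ℕ
  term (j , i) = (p + q + 2 * suc (toℕ j) * k + 1) ∸ suc (toℕ i)

  S≡term : ∀ a → S a ≡ term (remQuot k a)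
  S≡term a = sym (begin
    (p + q + 2 * suc (toℕ j) * k + 1) ∸ suc (toℕ i)
      -- Isolating one summand k confines the truncated subtraction to `k ∸ suc (toℕ i)`, which is
      -- exact because i < k and equals the reversed offset.
      ≡⟨ cong (_∸ suc (toℕ i)) (split-block (p + q) (toℕ j) k) ⟩
    (suc (p + q + ((k + k) * toℕ j + k)) + k) ∸ suc (toℕ i)
      ≡⟨ +-∸-assoc _ (toℕ<n i) ⟩
    suc (p + q + ((k + k) * toℕ j + k)) + (k ∸ suc (toℕ i))
      ≡⟨ cong (suc (p + q + ((k + k) * toℕ j + k)) +_) (opposite-prop i) ⟨
    suc (p + q + ((k + k) * toℕ j + k)) + toℕ (opposite i)
      ≡⟨ reassociate (p + q) ((k + k) * toℕ j) k (toℕ (opposite i)) ⟩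
    suc (p + q + ((k + k) * toℕ j + (k + toℕ (opposite i))))
      ≡⟨ cong (λ x → suc (p + q + x)) (position-edge a) ⟨
    S a ∎)
    where
    open ≡-Reasoning
    j = proj₁ (remQuot {s} k a)
    i = proj₂ (remQuot {s} k a)
    split-block : ∀ n j k → n + 2 * suc j * k + 1 ≡ suc (n + ((k + k) * j + k)) + k
    split-block = solve-∀
    reassociate : ∀ n x k y → suc (n + (x + k)) + y ≡ suc (n + (x + (k + y)))
    reassociate = solve-∀

  ΣS≡ : ΣS ≡ ∑[1⋯ s ] (λ j → ∑[1⋯ k ] (λ i → (p + q + 2 * j * k + 1) ∸ i))
  ΣS≡ = begin
    sum (map S (allFin m))            ≡⟨ cong sum (map-tabulate id S) ⟩
    sum (tabulate S)                  ≡⟨ cong sum (tabulate-cong S≡term) ⟩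
    sum (tabulate (term ∘ remQuot k)) ≡⟨ sum-remQuot s k term ⟩
    sum (tabulate {n = s} λ j → sum (tabulate {n = k} λ i → term (j , i)))
      ≡⟨ cong sum (tabulate-cong {n = s} λ j →
           ∑-tabulate k (λ i → (p + q + 2 * suc (toℕ j) * k + 1) ∸ i)) ⟨
    sum (tabulate {n = s} λ j → ∑[1⋯ k ] (λ i → (p + q + 2 * suc (toℕ j) * k + 1) ∸ i))
      ≡⟨ ∑-tabulate s (λ j → ∑[1⋯ k ] (λ i → (p + q + 2 * j * k + 1) ∸ i)) ⟨
    ∑[1⋯ s ] (λ j → ∑[1⋯ k ] (λ i → (p + q + 2 * j * k + 1) ∸ i)) ∎
    where open ≡-Reasoning

  -- The upper half of the block with number j, counted from 1, begins after (2j - 1)k positions, so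
  -- the range in (c) consists of values of `S`. Inverting `cell` finds the edge.
  S-surjective : ∀ {j i} → 1 ≤ j → j ≤ s → 1 ≤ i → i ≤ k →
                 ∃ λ a → S a ≡ p + q + (2 * j ∸ 1) * k + i
  S-surjective {suc j} {suc i} _ j<s _ i<k = a , (begin
    suc (p + q + toℕ (Inverse.to position (inj₂ a)))
      ≡⟨ cong (λ x → suc (p + q + x)) (position-edge a) ⟩
    value (Inverse.to cell a)
      ≡⟨ cong value (Inverse.strictlyInverseˡ cell (fromℕ< j<s , fromℕ< i<k)) ⟩
    value (fromℕ< j<s , fromℕ< i<k)
      ≡⟨ cong₂ (λ j i → suc (p + q + ((k + k) * j + (k + i)))) (toℕ-fromℕ< j<s) (toℕ-fromℕ< i<k) ⟩
    suc (p + q + ((k + k) * j + (k + i)))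
      ≡⟨ collect (p + q) j k i ⟩
    -- The factor is the normal form of `2 * suc j ∸ 1`.
    p + q + (j + suc (j + 0)) * k + suc i ∎)
    where
    open ≡-Reasoning
    a = Inverse.from cell (fromℕ< j<s , fromℕ< i<k)
    value : Fin s × Fin k → ℕ
    value (j , i) = suc (p + q + ((k + k) * toℕ j + (k + toℕ i)))
    collect : ∀ n j k i → suc (n + ((k + k) * j + (k + i))) ≡ n + (j + suc (j + 0)) * k + suc i
    collect = solve-∀

  extend-lta : LocalTotalAntimagic Gᵥ extend
  extend-lta = extension-lta lta S-injective (Bijection.injective (↔⇒⤖ ρ))
    (proj₂ (fixedPointFree 2≤sk)) S-large (fromℕ< (≤-trans (s≤s z≤n) 2≤sk))
    (weight-positive G f (proj₂ (Admissible.noIsolated admissible v)))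
    (λ x adj → condition-b x adj ∘ trans (cong (weight G f (inj₁ v) +_) (sym ΣS≡)))

  ΔGᵥ≡ : Δ Gᵥ ≡ Δ G + m
  ΔGᵥ≡ = Δ-attach v-max (≤-trans (s≤s z≤n) 2≤sk)

  -- After the attachment `v` has maximum degree, so the degree bound is applied there.
  lower : ∀ g → LocalTotalAntimagic Gᵥ g → Δ Gᵥ + 1 ≤ #weights Gᵥ g
  lower g ltag = subst (λ n → n + 1 ≤ #weights Gᵥ g)
    (trans deg-v (trans (cong (_+ m) v-max) (sym ΔGᵥ≡))) (deg+1≤#weights Gᵥ (v ↑ˡ m) g ltag)

  m+#weights : m + #weights G f ≡ Δ Gᵥ + 1
  m+#weights = trans (cong (m +_) #f≡)
    (trans (rotate m (Δ G)) (cong (_+ 1) (sym ΔGᵥ≡)))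
    where
    rotate : ∀ m d → m + (d + 1) ≡ (d + m) + 1
    rotate = solve-∀

  between : ∃ λ χ → χlt≡ Gᵥ χ × Δ Gᵥ + 1 ≤ χ × χ ≤ Δ Gᵥ + 2
  between = let χ , χ≡ , l , u = χlt-between Gᵥ lower extend extend-lta
                      (≤-trans #weights-extension (≤-reflexive (cong suc m+#weights)))
            in χ , χ≡ , l , ≤-trans u (≤-reflexive (sym (+-suc (Δ Gᵥ) 1)))

  attained : _ → χlt≡ Gᵥ (Δ Gᵥ + 1)
  attained condition-c = (extend , extend-lta , ≤-antisym
    (≤-trans (tight condition-c) (≤-reflexive m+#weights)) (lower extend extend-lta)) , lower
    where
    tight : (∀ y → weight G f y ≡ weight G f (inj₁ v) → y ≡ inj₁ v)
            ⊎ (Σ (Element p q) λ y → ∃ λ j → ∃ λ i →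
                1 ≤ j × j ≤ s × 1 ≤ i × i ≤ k × weight G f y ≡ p + q + (2 * j ∸ 1) * k + i) →
            #weights Gᵥ extend ≤ m + #weights G f
    -- The weight struck out is the old weight of `v`, which no other element shares.
    tight (inj₁ alone) = #weights-extension-tight (inj₁ v) λ y y≢v eq →
      contradiction (alone y eq) y≢v
    tight (inj₂ (y , j , i , 1≤j , j≤s , 1≤i , i≤k , wy≡))
      with a , Sa≡ ← S-surjective 1≤j j≤s 1≤i i≤k =
      -- Here the weight struck out is that of `y`, already counted as a value of `S`.
      #weights-extension-tight y λ _ _ _ →
        subst (_∈ newWeights) (trans Sa≡ (sym wy≡)) (S∈newWeights a)

theorem2p4 : ∀ (k s : ℕ) → 1 ≤ k → 1 ≤ s → 2 ≤ k * s →
    ∀ (p q d : ℕ) (G : Graph p q) → Admissible G → #pendantEdges G ≡ d →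
    ∀ (v : Fin p) (f : Labeling p q) (t : ℕ) →
    -- (a)
    χlt≡ G t → t ≡ Δ G + 1 →
    LocalTotalAntimagic G f → #weights G f ≡ t →
    deg G v ≡ Δ G → label f (inj₁ v) ≡ k →
    -- (b)
    (∀ (x : Fin p) → Adjacent G v x →
      weight G f (inj₁ v)
        + ∑[1⋯ s ] (λ j → ∑[1⋯ k ] (λ i → (p + q + 2 * j * k + 1) ∸ i))
      ≢ weight G f (inj₁ x)) →
    let Gᵥ = attachPendants G v (k * s) in
    (∃ λ χ → χlt≡ Gᵥ χ × Δ Gᵥ + 1 ≤ χ × χ ≤ Δ Gᵥ + 2)
    ×
    -- (c)
    ( ( (∀ (y : Element p q) → weight G f y ≡ weight G f (inj₁ v) → y ≡ inj₁ v)
      ⊎ (Σ (Element p q) λ y →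
          (∀ (u : Fin p) → y ≡ inj₁ u → ¬ Pendant G u)
          × ∃ λ j → ∃ λ i →
              1 ≤ j × j ≤ s × 1 ≤ i × i ≤ k
              × weight G f y ≡ p + q + (2 * j ∸ 1) * k + i))
      → χlt≡ Gᵥ (Δ Gᵥ + 1))
theorem2p4 k s _ _ 2≤ks p q _ G admissible _ v f t _ t≡ lta #f≡t v-max fv≡k condition-b
  with between , attained ← attachBlocks k s (subst (2 ≤_) (*-comm k s) 2≤ks) (*-comm k s)
         G admissible v f lta (trans #f≡t t≡) v-max fv≡k condition-b =
  between , attained ∘ [ inj₁ , (λ (y , _ , rest) → inj₂ (y , rest)) ]′
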